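{- There exists $N_0$ such that for every integer $N\ge N_0$, $$\#\big(W\cap\{1,\dots,N\}\big)\le N^{0.9999},$$ where $$W:=\Big\{n\in\mathbb Z\;:\;\exists k\ge0,\ T^k(n)=1\ \text{ and }\ \forall i\in I,\ \frac{c_i(n)}{\sum_{j\in I}c_j(n)}\le\frac16+0.0215\Big\}.$$
   Context: $T:\mathbb Z\to\mathbb Z$ is defined by $T(n)=3n+1$ if $n$ is odd and $T(n)=n/2$ if $n$ is even; $T^k$ is its $k$-th iterate. For $n\in\mathbb Z$, the orbit of $n$ is the set $\mathcal O_n:=\{m\in\mathbb Z: \exists k\ge0,\ m=T^k(n)\}$. For an integer $i$, $c_i(n):=\#\{m\in\mathcal O_n: m\equiv i \bmod 18\}$ (finite or infinite; it is finite when the orbit of $n$ contains $1$). $I:=\{1,5,7,11,13,17\}$. -}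

module Defs where

open import Data.Bool.Base using (if_then_else_)
open import Data.Integer.Base using (ℤ; +_; 0ℤ; 1ℤ; _+_; _-_; _*_; _≤_; _/ℕ_)
open import Data.Integer.Divisibility.Signed using (_∣_; _∣?_; divides)
open import Data.List.Base using (List; []; _∷_; length; map)
open import Data.List.Membership.Propositional using (_∈_)
open import Data.List.Relation.Unary.All using (All)
open import Data.List.Relation.Unary.Any using (here)
open import Data.List.Relation.Unary.Unique.Propositional using (Unique)
open import Data.Nat.Base as ℕ using (ℕ; suc; NonZero; _^_)
open import Data.Nat.GeneralisedArithmetic using (iterate)
open import Data.Nat.ListAction using (sum)
open import Data.Product.Base using (∃; _×_; _,_)
open import Data.Rational.Unnormalised.Base as ℚ using (_/_)
open import Function.Bundles using (_⇔_; module Equivalence)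
open import Level using (0ℓ)
open import Relation.Binary.PropositionalEquality.Core using (_≡_; refl; sym)
open import Relation.Nullary.Decidable.Core using (does)
open import Relation.Unary using (Pred; _∩_)

T : ℤ → ℤ
T n = if does (+ 2 ∣? n) then n /ℕ 2 else + 3 * n + 1ℤ

T^ : ℕ → ℤ → ℤ
T^ k n = iterate T n k

Orbit : ℤ → Pred ℤ 0ℓ
Orbit n m = ∃ λ k → m ≡ T^ k n

infix 4 _≡_[mod_]

_≡_[mod_] : ℤ → ℤ → ℤ → Set
m ≡ i [mod d ] = d ∣ m - i

-- P is finite with exactly k elements.  Elements are listed rather than put in
-- bijection with Σ ℤ P, since P need not be proof-irrelevant: a point of an
-- orbit may be reached at many times k.
HasSize : Pred ℤ 0ℓ → ℕ → Set
HasSize P k = ∃ λ xs → Unique xs × (∀ m → m ∈ xs ⇔ P m) × length xs ≡ k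

OrbitClass : ℤ → ℤ → Pred ℤ 0ℓ
OrbitClass i n = Orbit n ∩ (_≡ i [mod + 18 ])

I : List ℤ
I = + 1 ∷ + 5 ∷ + 7 ∷ + 11 ∷ + 13 ∷ + 17 ∷ []

-- c i is cᵢ(n) for every i ∈ I; values of c outside I are irrelevant.
IsCount : ℤ → (ℤ → ℕ) → Set
IsCount n c = ∀ {i} → i ∈ I → HasSize (OrbitClass i n) (c i)

total : (ℤ → ℕ) → ℕ
total c = sum (map c I)

-- The denominator of the ratios does not vanish: 1 is itself counted by c₁(n).
total-nonZero : ∀ {n c} → ∃ (λ k → T^ k n ≡ 1ℤ) → IsCount n c → NonZero (total c)
total-nonZero {n} {c} (k , Tᵏn≡1) counts with c (+ 1) | counts (here refl)
... | suc _ | _ = _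
... | 0 | [] , _ , enumerates , _
  with () ← Equivalence.from (enumerates 1ℤ) ((k , sym Tᵏn≡1) , divides 0ℤ refl)
... | 0 | _ ∷ _ , _ , _ , ()

-- When the orbit of n contains 1 it is finite, so c exists and is unique on I.
record W (n : ℤ) : Set where
  field
    reaches-1 : ∃ λ k → T^ k n ≡ 1ℤ
    c         : ℤ → ℕ
    isCount   : IsCount n c

  instance
    nonZero : NonZero (total c)
    nonZero = total-nonZero reaches-1 isCount

  field
    ratio≤ : ∀ {i} → i ∈ I →
             (+ c i) / total c ℚ.≤ (+ 1) / 6 ℚ.+ (+ 215) / 10000

[1⋯_] : ℕ → Pred ℤ 0ℓ
[1⋯ N ] n = 1ℤ ≤ n × n ≤ + N

-- #P ≤ N^(p/q), for q > 0.  The real inequality k ≤ N^(p/q) between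
-- nonnegative numbers is k^q ≤ N^p.  P need not be decidable, so its
-- cardinality is bounded by bounding the number of distinct elements in any
-- list drawn from P.
#_≤_^[_/_] : Pred ℤ 0ℓ → ℕ → (p q : ℕ) .{{_ : NonZero q}} → Set
# P ≤ N ^[ p / q ] = ∀ xs → Unique xs → All P xs → length xs ^ q ℕ.≤ N ^ p

-- A Collatz path from n to 1 with A halvings and s triplings has 2^A ≲ n·3^s, so
-- with σ = 99/100 its weight 2^(-σA)·3^(σs) is at least about n^(-σ).  On the
-- backward tree of 1 the weights are normalised by a factor depending on the
-- class mod 18 of each odd vertex, so that a function of the residue mod 18 is a
-- supersolution of the branching recursion; hence the normalised weights have a
-- bounded sum.  The normalising factors lose on some classes and gain on others,
-- the gain being largest on the class of 7.  If no class has proportion above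
-- 4/21, which exceeds 1/6 + 0.0215, then 7 has proportion at least 1/21 and the
-- product of the factors along the path exceeds the losses from the rounding of
-- the constants and from 3n + 1 > 3n.  So every n ≤ N in W carries a normalised
-- weight ≫ N^(-σ), and there are only O(N^σ) such n.

module Submission where

open import Defs
open import Data.Bool.Base using (true; false; if_then_else_) renaming (T to True)
open import Data.Integer.Base as ℤ using (ℤ; +_; 1ℤ)
import Data.Integer.Divisibility.Signed as ℤ
import Data.Integer.Properties as ℤ
open import Data.List.Base using (List; []; _∷_; _++_; [_]; length; map; concatMap; filter)
import Data.List.Membership.DecPropositional as DecMembership
open import Data.List.Membership.Propositional using (_∈_; _∉_)
open import Data.List.Membership.Propositional.Properties
  using (∈-∃++; ∈-++⁻; ∈-++⁺ˡ; ∈-++⁺ʳ; ∈-concatMap⁺; ∈-map⁺; ∈-map⁻; ∈-filter⁺; ∈-filter⁻)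
open import Data.List.Properties using (length-++; length-map; map-cong; map-cong-local)
open import Data.List.Relation.Unary.All as All using (All; []; _∷_)
open import Data.List.Relation.Unary.All.Properties.Core using (¬Any⇒All¬)
open import Data.List.Relation.Unary.Any as Any using (here; there)
open import Data.List.Relation.Unary.Unique.Propositional using (Unique; []; _∷_)
import Data.List.Relation.Unary.Unique.Propositional.Properties as Unique
open import Data.Nat.Base
open import Data.Nat.DivMod
open import Data.Nat.Divisibility as ℕ∣ using (divides)
open import Data.Nat.ListAction using (sum; product)
open import Data.Nat.Properties
open import Data.Nat.Tactic.RingSolver using (solve-∀)
open import Data.Product.Base using (∃; _×_; _,_; proj₁; proj₂)
open import Data.Rational.Unnormalised.Base as ℚ using (*≤*)
open import Data.Sum.Base as Sum using (_⊎_; inj₁; inj₂)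
open import Function.Bundles using (Equivalence)
open import Relation.Binary.PropositionalEquality hiding ([_])
open import Relation.Nullary.Decidable using (Dec; yes; no; dec-true; dec-false; from-yes; _×-dec_; _→-dec_; ¬?)
open import Relation.Nullary.Negation using (¬_; contradiction)
open import Relation.Unary using (_∩_)

open DecMembership _≟_ using (_∈?_)

private variable n : ℕ

-- Class weights, and a potential solving the branching inequality

-- E / D is just above 2^(-99/100).  The weights are chosen with
-- weightᵣ r * potentialᵣ r ≤ D * 2000 at the odd residues prime to 3, and the
-- potential is then the least solution, rounded up, of the recursion
-- D + load v ≤ D * potential v below.  Odd multiples of 3 have no odd predecessors.
opaque
  D : ℕ
  D = 2000

  E : ℕ
  E = 1007

  weightᵣ : ℕ → ℕ
  weightᵣ 1  = 6163
  weightᵣ 5  = 12195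
  weightᵣ 7  = 23952
  weightᵣ 11 = 3110
  weightᵣ 13 = 7246
  weightᵣ 17 = 3659
  weightᵣ _  = 1

  potentialᵣ : ℕ → ℕ
  potentialᵣ 1  = 649
  potentialᵣ 2  = 1286
  potentialᵣ 4  = 2552
  potentialᵣ 5  = 328
  potentialᵣ 7  = 167
  potentialᵣ 8  = 1093
  potentialᵣ 10 = 649
  potentialᵣ 11 = 1286
  potentialᵣ 13 = 552
  potentialᵣ 14 = 328
  potentialᵣ 16 = 2167
  potentialᵣ 17 = 1093
  potentialᵣ _  = 3

-- Divided by `D`, this is the factor by which the weight changes on passing back to a vertex: about
-- 2^(-99/100) when a halving is undone, the class weight over `D` when a tripling is undone.
gainᵣ : ℕ → ℕ
gainᵣ r = if r % 2 ≡ᵇ 0 then E else weightᵣ r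

weight gain potential : ℕ → ℕ
weight n    = weightᵣ (n % 18)
gain n      = gainᵣ (n % 18)
potential n = potentialᵣ (n % 18)

-- The preimages of `v` under `T`: for v ≡ 4 mod 6 the quotient `v / 3` is (v - 1)/3. As 1 is a
-- child of 4, the tree runs round the cycle 1, 2, 4 and lists vertices repeatedly, which is
-- harmless for an upper bound.
children : ℕ → List ℕ
children v = 2 * v ∷ (if v % 6 ≡ᵇ 4 then [ v / 3 ] else [])

term load : ℕ → ℕ
term u = gain u * potential u
load v = sum (map term (children v))

term-cong : ∀ m n → m % 18 ≡ n % 18 → term m ≡ term n
term-cong _ _ = cong (λ r → gainᵣ r * potentialᵣ r)

opaque
  unfolding D

  nonZero-D : NonZero D
  nonZero-D = _

  supersolution-< : ∀ {r} → r < 54 → D + load r ≤ D * potential r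
  supersolution-< = from-yes (allUpTo? (λ r → D + load r ≤? D * potential r) 54)

-- The modulus is 54 because the class of `v / 3` modulo 18 is determined by `v` modulo 54. This
-- reduces `supersolution` to a finite check.
load-%54 : ∀ v → load v ≡ load (v % 54)
load-%54 v = cong₂ _+_ doubled tripled
  where
  open ≡-Reasoning
  mod18 : v % 54 % 18 ≡ v % 18
  mod18 = m∣n⇒o%n%m≡o%m 18 54 v (divides 3 refl)
  doubled : term (2 * v) ≡ term (2 * (v % 54))
  doubled = term-cong (2 * v) (2 * (v % 54)) (begin
    2 * v % 18                 ≡⟨ %-distribˡ-* 2 v 18 ⟩
    2 * (v % 18) % 18          ≡⟨ cong (λ r → 2 * r % 18) mod18 ⟨
    2 * (v % 54 % 18) % 18     ≡⟨ %-distribˡ-* 2 (v % 54) 18 ⟨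
    2 * (v % 54) % 18          ∎)
  third : v % 54 / 3 % 18 ≡ v / 3 % 18
  third = trans (cong (_% 18) (m%[n*o]/o≡m/o%n v 18 3)) (m%n%n≡m%n (v / 3) 18)
  tripled : sum (map term (if v % 6 ≡ᵇ 4 then [ v / 3 ] else [])) ≡
            sum (map term (if v % 54 % 6 ≡ᵇ 4 then [ v % 54 / 3 ] else []))
  tripled rewrite m∣n⇒o%n%m≡o%m 6 54 v (divides 9 refl) with v % 6 ≡ᵇ 4
  ... | true  = cong (_+ 0) (term-cong (v / 3) (v % 54 / 3) (sym third))
  ... | false = refl

supersolution : ∀ v → D + load v ≤ D * potential v
supersolution v
  rewrite load-%54 v | sym (cong potentialᵣ (m∣n⇒o%n%m≡o%m 18 54 v (divides 3 refl)))
  = supersolution-< (m%n<n v 54)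

-- The backward tree and its size

-- The backward tree above v, cut off at height fuel, where v has weight num / den;
-- only the vertices of weight at least 1 / B are listed.
tree : (B fuel v num den : ℕ) → List ℕ
tree B zero       v num den = []
tree B (suc fuel) v num den =
  (if den ≤ᵇ num * B then [ v ] else []) ++
  concatMap (λ u → tree B fuel u (gain u * num) (D * den)) (children v)

-- Induction on the height: after multiplication by `D`, the vertex `v`, if listed, is paid for by
-- the summand `D` in `supersolution` and the subtrees by `load v`. The bound is uniform in `fuel`.
length-tree : ∀ B fuel v num den →
              length (tree B fuel v num den) * den ≤ num * B * potential v
length-tree B zero       v num den = z≤n
length-tree B (suc fuel) v num den = *-cancelˡ-≤ D {{nonZero-D}} (begin
  D * (length (root ++ subtrees (children v)) * den)
    ≡⟨ cong (λ l → D * (l * den)) (length-++ root) ⟩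
  D * ((length root + length (subtrees (children v))) * den)
    ≡⟨ distribute D (length root) (length (subtrees (children v))) den ⟩
  length root * den * D + length (subtrees (children v)) * (D * den)
    ≤⟨ +-mono-≤ (*-monoˡ-≤ D root-≤) (subtrees-≤ (children v)) ⟩
  num * B * D + num * B * load v
    ≡⟨ *-distribˡ-+ (num * B) D (load v) ⟨
  num * B * (D + load v)
    ≤⟨ *-monoʳ-≤ (num * B) (supersolution v) ⟩
  num * B * (D * potential v)
    ≡⟨ swap (num * B) D (potential v) ⟩
  D * (num * B * potential v) ∎)
  where
  open ≤-Reasoning
  root : List ℕ
  root = if den ≤ᵇ num * B then [ v ] else []
  subtree : ℕ → List ℕ
  subtree u = tree B fuel u (gain u * num) (D * den)
  subtrees : List ℕ → List ℕ
  subtrees = concatMap subtree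
  distribute : ∀ a b c d → a * ((b + c) * d) ≡ b * d * a + c * (a * d)
  distribute = solve-∀
  swap : ∀ a b c → a * (b * c) ≡ b * (a * c)
  swap = solve-∀
  factor : ∀ a b c d e → a * b * c * d + b * c * e ≡ b * c * (a * d + e)
  factor = solve-∀
  root-≤ : length root * den ≤ num * B
  root-≤ with den ≤ᵇ num * B in eq
  ... | true  = ≤-trans (≤-reflexive (*-identityˡ den)) (≤ᵇ⇒≤ den (num * B) (subst True (sym eq) _))
  ... | false = z≤n
  subtrees-≤ : ∀ us → length (subtrees us) * (D * den) ≤ num * B * sum (map term us)
  subtrees-≤ []       = z≤n
  subtrees-≤ (u ∷ us) = begin
    length (subtree u ++ subtrees us) * (D * den)
      ≡⟨ cong (_* (D * den)) (length-++ (subtree u)) ⟩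
    (length (subtree u) + length (subtrees us)) * (D * den)
      ≡⟨ *-distribʳ-+ (D * den) (length (subtree u)) (length (subtrees us)) ⟩
    length (subtree u) * (D * den) + length (subtrees us) * (D * den)
      ≤⟨ +-mono-≤ (length-tree B fuel u (gain u * num) (D * den)) (subtrees-≤ us) ⟩
    gain u * num * B * potential u + num * B * sum (map term us)
      ≡⟨ factor (gain u) num B (potential u) (sum (map term us)) ⟩
    num * B * sum (map term (u ∷ us)) ∎

root∈tree : ∀ {B v num den} fuel → den ≤ num * B → v ∈ tree B (suc fuel) v num den
root∈tree {B} {v} {num} {den} fuel le with den ≤ᵇ num * B | ≤⇒≤ᵇ le
... | true | _ = here refl

subtree⊆tree : ∀ {B fuel u v num den x} → u ∈ children v →
               x ∈ tree B fuel u (gain u * num) (D * den) → x ∈ tree B (suc fuel) v num den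
subtree⊆tree {B} {v = v} {num} {den} u∈ x∈ =
  ∈-++⁺ʳ (if den ≤ᵇ num * B then [ v ] else []) (∈-concatMap⁺ _ (Any.map (λ { refl → x∈ }) u∈))

-- Paths to 1 as branches of the tree

-- The condition `1 < n` makes a path end at its first visit to 1 instead of going round the cycle.
data Path : ℕ → Set where
  stop   : Path 1
  halve  : ∀ {n} m → n ≡ 2 * m → Path m → Path n
  triple : ∀ {n} m → n ≡ 1 + 2 * m → 1 < n → Path (1 + 3 * n) → Path n

steps : Path n → ℕ
steps stop             = 0
steps (halve _ _ π)    = suc (steps π)
steps (triple _ _ _ π) = suc (steps π)

numerator : Path n → ℕ
numerator stop                 = 1
numerator {n} (halve _ _ π)    = gain n * numerator π
numerator {n} (triple _ _ _ π) = gain n * numerator π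

denominator : Path n → ℕ
denominator π = D ^ steps π

odd∈children : ∀ m → 1 + 2 * m ∈ children (1 + 3 * (1 + 2 * m))
odd∈children m = branch (≡⇒≡ᵇ (v % 6) 4 v%6≡4)
  where
  v : ℕ
  v = 1 + 3 * (1 + 2 * m)
  v≡4+6m : ∀ m → 1 + 3 * (1 + 2 * m) ≡ 4 + m * 6
  v≡4+6m = solve-∀
  v%6≡4 : v % 6 ≡ 4
  v%6≡4 = trans (cong (_% 6) (v≡4+6m m)) ([m+kn]%n≡m%n 4 m 6)
  v/3≡1+2m : v / 3 ≡ 1 + 2 * m
  v/3≡1+2m = trans (+-distrib-/-∣ʳ 1 (divides (1 + 2 * m) (*-comm 3 (1 + 2 * m))))
    (trans (cong (_/ 3) (*-comm 3 (1 + 2 * m))) (m*n/n≡m (1 + 2 * m) 3))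
  branch : True (v % 6 ≡ᵇ 4) → 1 + 2 * m ∈ children v
  branch t with true ← v % 6 ≡ᵇ 4 = there (here (sym v/3≡1+2m))

-- Read backwards from 1, a path climbs one level of the tree per step, and `numerator π` over
-- `denominator π` is the weight that the tree accumulates on the way.
tree-extend : ∀ {B x} fuel (π : Path n) → x ∈ tree B fuel n (numerator π) (denominator π) →
              x ∈ tree B (steps π + fuel) 1 1 1
tree-extend fuel stop x∈ = x∈
tree-extend {B = B} {x} fuel (halve m refl π) x∈ =
  subst (λ f → x ∈ tree B f 1 1 1) (+-suc (steps π) fuel)
    (tree-extend (suc fuel) π (subtree⊆tree {fuel = fuel} (here refl) x∈))
tree-extend {B = B} {x} fuel (triple m refl _ π) x∈ =
  subst (λ f → x ∈ tree B f 1 1 1) (+-suc (steps π) fuel)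
    (tree-extend (suc fuel) π (subtree⊆tree {fuel = fuel} (odd∈children m) x∈))

-- Parity decides between halving and tripling, and neither can start at 1.
Path-irrelevant : (π π′ : Path n) → π ≡ π′
Path-irrelevant stop               stop                = refl
Path-irrelevant stop               (halve m eq _)      = contradiction (sym eq) (even≢odd m 0)
Path-irrelevant stop               (triple _ _ 1<1 _)  = contradiction 1<1 (<-irrefl refl)
Path-irrelevant (halve m eq _)     stop                = contradiction (sym eq) (even≢odd m 0)
Path-irrelevant (halve m refl π)   (halve m′ eq π′) with refl ← *-cancelˡ-≡ m m′ 2 eq | refl ← eq =
  cong (halve m refl) (Path-irrelevant π π′)
Path-irrelevant (halve m refl _)   (triple k eq _ _)   = contradiction eq (even≢odd m k)
Path-irrelevant (triple _ _ 1<1 _) stop                = contradiction 1<1 (<-irrefl refl)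
Path-irrelevant (triple k eq _ _)  (halve m refl _)    = contradiction eq (even≢odd m k)
Path-irrelevant (triple k refl l π) (triple k′ eq l′ π′)
  with refl ← *-cancelˡ-≡ k k′ 2 (suc-injective eq) | refl ← eq | refl ← <-irrelevant l l′ =
  cong (triple k refl l) (Path-irrelevant π π′)

-- Vertices of a path by residue class

nodes : Path n → List ℕ
nodes stop                 = [ 1 ]
nodes {n} (halve _ _ π)    = n ∷ nodes π
nodes {n} (triple _ _ _ π) = n ∷ nodes π

classes : List ℕ
classes = 1 ∷ 5 ∷ 7 ∷ 11 ∷ 13 ∷ 17 ∷ []

δ : ℕ → ℕ → ℕ
δ i r = if r ≡ᵇ i then 1 else 0

count : ℕ → List ℕ → ℕ
count i ms = sum (map (λ m → δ i (m % 18)) ms)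

-- The six residues are the units modulo 18, so this counts the vertices prime to 6.
units : List ℕ → ℕ
units ms = sum (map (λ i → count i ms) classes)

unit : ℕ → ℕ
unit r = sum (map (λ i → δ i r) classes)

sum-map-+ : ∀ {A : Set} (f g : A → ℕ) xs → sum (map (λ x → f x + g x) xs) ≡ sum (map f xs) + sum (map g xs)
sum-map-+ f g []       = refl
sum-map-+ f g (x ∷ xs) = trans (cong (λ s → f x + g x + s) (sum-map-+ f g xs))
  (exchange (f x) (g x) (sum (map f xs)) (sum (map g xs)))
  where
  exchange : ∀ a b c d → (a + b) + (c + d) ≡ (a + c) + (b + d)
  exchange = solve-∀

units-∷ : ∀ m ms → units (m ∷ ms) ≡ unit (m % 18) + units ms
units-∷ m ms = sum-map-+ (λ i → δ i (m % 18)) (λ i → count i ms) classes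

totalWeight : List ℕ → ℕ
totalWeight ms = product (map weight ms)

opaque
  unfolding D

  -- Three kinds of vertex behave differently along a path: even, prime to 6, and odd multiple of 3.
  -- Only the second kind belongs to the six classes.
  even-node-< : ∀ {r} → r < 18 → r % 2 ≡ 0 → gainᵣ r ≡ E × weightᵣ r ≡ 1 × unit r ≡ 0
  unit-node-< : ∀ {r} → r < 18 → r % 2 ≡ 1 → r % 3 ≢ 0 → gainᵣ r ≡ weightᵣ r × unit r ≡ 1
  multiple-node-< : ∀ {r} → r < 18 → r % 2 ≡ 1 → r % 3 ≡ 0 → gainᵣ r ≡ 1 × weightᵣ r ≡ 1 × unit r ≡ 0

  even-node-< = from-yes (allUpTo? (λ r → r % 2 ≟ 0 →-dec (gainᵣ r ≟ E ×-dec weightᵣ r ≟ 1 ×-dec unit r ≟ 0)) 18)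
  unit-node-< = from-yes (allUpTo? (λ r → r % 2 ≟ 1 →-dec ¬? (r % 3 ≟ 0) →-dec
    (gainᵣ r ≟ weightᵣ r ×-dec unit r ≟ 1)) 18)
  multiple-node-< = from-yes (allUpTo? (λ r → r % 2 ≟ 1 →-dec r % 3 ≟ 0 →-dec
    (gainᵣ r ≟ 1 ×-dec weightᵣ r ≟ 1 ×-dec unit r ≟ 0)) 18)

%18%2 : ∀ n → n % 18 % 2 ≡ n % 2
%18%2 n = m∣n⇒o%n%m≡o%m 2 18 n (divides 9 refl)

%18%3 : ∀ n → n % 18 % 3 ≡ n % 3
%18%3 n = m∣n⇒o%n%m≡o%m 3 18 n (divides 6 refl)

2*m%2≡0 : ∀ m → 2 * m % 2 ≡ 0
2*m%2≡0 m = trans (cong (_% 2) (*-comm 2 m)) (m*n%n≡0 m 2)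

[1+2*m]%2≡1 : ∀ m → (1 + 2 * m) % 2 ≡ 1
[1+2*m]%2≡1 m = trans (cong (λ l → (1 + l) % 2) (*-comm 2 m)) ([m+kn]%n≡m%n 1 m 2)

even-node : ∀ m → gain (2 * m) ≡ E × weight (2 * m) ≡ 1 × unit (2 * m % 18) ≡ 0
even-node m = even-node-< (m%n<n (2 * m) 18) (trans (%18%2 (2 * m)) (2*m%2≡0 m))

unit-node : ∀ m → (1 + 2 * m) % 3 ≢ 0 →
            gain (1 + 2 * m) ≡ weight (1 + 2 * m) × unit ((1 + 2 * m) % 18) ≡ 1
unit-node m v%3≢0 = unit-node-< (m%n<n v 18) (trans (%18%2 v) ([1+2*m]%2≡1 m))
  (λ eq → v%3≢0 (trans (sym (%18%3 v)) eq))
  where v = 1 + 2 * m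

multiple-node : ∀ m → (1 + 2 * m) % 3 ≡ 0 →
                gain (1 + 2 * m) ≡ 1 × weight (1 + 2 * m) ≡ 1 × unit ((1 + 2 * m) % 18) ≡ 0
multiple-node m v%3≡0 = multiple-node-< (m%n<n v 18) (trans (%18%2 v) ([1+2*m]%2≡1 m))
  (trans (%18%3 v) v%3≡0)
  where v = 1 + 2 * m

^-distribʳ-* : ∀ m n o → (m * n) ^ o ≡ m ^ o * n ^ o
^-distribʳ-* m n zero    = refl
^-distribʳ-* m n (suc o) = trans (cong (m * n *_) (^-distribʳ-* m n o)) (exchange m n (m ^ o) (n ^ o))
  where
  exchange : ∀ a b c d → a * b * (c * d) ≡ a * c * (b * d)
  exchange = solve-∀

-- Lower bound for the weight of a path

-- A / R = D^q (34/11)^p per tripling, as 3n + 1 ≤ (34/11) n for n ≥ 11.  The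
-- constant κ′ additionally covers the one odd multiple of 3 a path can contain,
-- which has weight 1 instead of about 3^σ D.
opaque
  unfolding D

  p q A R κ κ′ : ℕ
  p  = 99
  q  = 100
  A  = D ^ q * 34 ^ p
  R  = 11 ^ p
  κ  = 2
  κ′ = 4 * (D * D) * κ

  -- That is, E / D ≥ 2^(-p/q): the rounding of the constant favours the lower bound.
  halving-≤ : D ^ q ≤ E ^ q * 2 ^ p
  halving-≤ = ≤ᵇ⇒≤ _ _ _

  A≡ : A ≡ D ^ q * 34 ^ p
  A≡ = refl

  R≡ : R ≡ 11 ^ p
  R≡ = refl

  κ′≡ : κ′ ≡ 4 * (D * D) * κ
  κ′≡ = refl

  κ≤κ′ : κ ≤ κ′
  κ≤κ′ = ≤ᵇ⇒≤ _ _ _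

  -- Turns a q-th power into a p-th power, so that a lost factor `D` can be absorbed into `κ′`.
  D^q≤[D*D]^p : D ^ q ≤ (D * D) ^ p
  D^q≤[D*D]^p = ≤ᵇ⇒≤ _ _ _

-- Dividing by the denominators: weight of π * n^σ * (A/R)^(s/q) ≥ totalWeight / k^σ,
-- with s the number of vertices in the six classes.
Inv : ℕ → Path n → Set
Inv {n} k π = (denominator π * totalWeight (nodes π)) ^ q * R ^ units (nodes π) ≤
              numerator π ^ q * (k * n) ^ p * A ^ units (nodes π)

halve-step : ∀ k X W Y m r a → (X * W) ^ q * r ≤ Y ^ q * (k * m) ^ p * a →
             (D * X * W) ^ q * r ≤ (E * Y) ^ q * (k * (2 * m)) ^ p * a
halve-step k X W Y m r a h = begin
  (D * X * W) ^ q * r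
    ≡⟨ cong (_* r) (trans (cong (_^ q) (*-assoc D X W)) (^-distribʳ-* D (X * W) q)) ⟩
  D ^ q * (X * W) ^ q * r
    ≡⟨ *-assoc (D ^ q) _ r ⟩
  D ^ q * ((X * W) ^ q * r)
    ≤⟨ *-mono-≤ halving-≤ h ⟩
  E ^ q * 2 ^ p * (Y ^ q * (k * m) ^ p * a)
    ≡⟨ exchange (E ^ q) (2 ^ p) (Y ^ q) ((k * m) ^ p) a ⟩
  E ^ q * Y ^ q * (2 ^ p * (k * m) ^ p) * a
    ≡⟨ cong₂ (λ x y → x * y * a) (sym (^-distribʳ-* E Y q))
         (trans (sym (^-distribʳ-* 2 (k * m) p)) (cong (_^ p) (swap 2 k m))) ⟩
  (E * Y) ^ q * (k * (2 * m)) ^ p * a ∎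
  where
  open ≤-Reasoning
  exchange : ∀ a b c d e → a * b * (c * d * e) ≡ a * c * (b * d) * e
  exchange = solve-∀
  swap : ∀ a b c → a * (b * c) ≡ b * (a * c)
  swap = solve-∀

inv-halve : ∀ k m (π : Path m) → Inv k π → Inv k (halve m refl π)
inv-halve k m π h with even-node m
... | gain≡ , weight≡ , unit≡
  rewrite units-∷ (2 * m) (nodes π) | gain≡ | weight≡ | unit≡ | +-identityʳ (totalWeight (nodes π)) =
  halve-step k (denominator π) (totalWeight (nodes π)) (numerator π) m _ _ h

-- The class weight `w` enters both the total weight and the numerator, and cancels. There remain
-- the factor `D` of the denominator and the growth from n to 3n + 1, which the new factor A / R
-- covers.
triple-step : ∀ k w X W Y n r a → 11 ≤ n → (X * W) ^ q * r ≤ Y ^ q * (k * (1 + 3 * n)) ^ p * a →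
              (D * X * (w * W)) ^ q * (R * r) ≤ (w * Y) ^ q * (k * n) ^ p * (A * a)
triple-step k w X W Y n r a 11≤n h = begin
  (D * X * (w * W)) ^ q * (R * r)
    ≡⟨ cong (λ x → x ^ q * (R * r)) (exchange₁ D X w W) ⟩
  (D * w * (X * W)) ^ q * (R * r)
    ≡⟨ cong (_* (R * r)) (trans (^-distribʳ-* (D * w) (X * W) q)
         (cong (_* (X * W) ^ q) (^-distribʳ-* D w q))) ⟩
  D ^ q * w ^ q * (X * W) ^ q * (R * r)
    ≡⟨ exchange₂ (D ^ q) (w ^ q) ((X * W) ^ q) R r ⟩
  D ^ q * w ^ q * R * ((X * W) ^ q * r)
    ≤⟨ *-monoʳ-≤ (D ^ q * w ^ q * R) h ⟩
  D ^ q * w ^ q * R * (Y ^ q * (k * (1 + 3 * n)) ^ p * a)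
    ≡⟨ exchange₃ (D ^ q) (w ^ q) R (Y ^ q) ((k * (1 + 3 * n)) ^ p) a ⟩
  D ^ q * (w ^ q * Y ^ q) * (R * (k * (1 + 3 * n)) ^ p) * a
    ≤⟨ *-monoˡ-≤ a (*-monoʳ-≤ (D ^ q * (w ^ q * Y ^ q)) growth) ⟩
  D ^ q * (w ^ q * Y ^ q) * (34 ^ p * (k * n) ^ p) * a
    ≡⟨ exchange₄ (D ^ q) (w ^ q * Y ^ q) (34 ^ p) ((k * n) ^ p) a ⟩
  w ^ q * Y ^ q * (k * n) ^ p * (D ^ q * 34 ^ p * a)
    ≡⟨ cong₂ (λ x y → x * (k * n) ^ p * (y * a)) (sym (^-distribʳ-* w Y q)) (sym A≡) ⟩
  (w * Y) ^ q * (k * n) ^ p * (A * a) ∎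
  where
  open ≤-Reasoning
  exchange₁ : ∀ a b c d → a * b * (c * d) ≡ a * c * (b * d)
  exchange₁ = solve-∀
  exchange₂ : ∀ a b c d e → a * b * c * (d * e) ≡ a * b * d * (c * e)
  exchange₂ = solve-∀
  exchange₃ : ∀ a b c d e f → a * b * c * (d * e * f) ≡ a * (b * d) * (c * e) * f
  exchange₃ = solve-∀
  exchange₄ : ∀ a b c d e → a * b * (c * d) * e ≡ b * d * (a * c * e)
  exchange₄ = solve-∀
  expand : ∀ k n → 11 * (k * (1 + 3 * n)) ≡ k * (11 + 33 * n)
  expand = solve-∀
  contract : ∀ k n → k * (n + 33 * n) ≡ 34 * (k * n)
  contract = solve-∀
  growth : R * (k * (1 + 3 * n)) ^ p ≤ 34 ^ p * (k * n) ^ p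
  growth = begin
    R * (k * (1 + 3 * n)) ^ p        ≡⟨ cong (_* (k * (1 + 3 * n)) ^ p) R≡ ⟩
    11 ^ p * (k * (1 + 3 * n)) ^ p   ≡⟨ ^-distribʳ-* 11 (k * (1 + 3 * n)) p ⟨
    (11 * (k * (1 + 3 * n))) ^ p     ≡⟨ cong (_^ p) (expand k n) ⟩
    (k * (11 + 33 * n)) ^ p          ≤⟨ ^-monoˡ-≤ p (*-monoʳ-≤ k (+-monoˡ-≤ (33 * n) 11≤n)) ⟩
    (k * (n + 33 * n)) ^ p           ≡⟨ cong (_^ p) (contract k n) ⟩
    (34 * (k * n)) ^ p               ≡⟨ ^-distribʳ-* 34 (k * n) p ⟩
    34 ^ p * (k * n) ^ p             ∎

inv-triple : ∀ m (π : Path (1 + 3 * (1 + 2 * m))) (l : 1 < 1 + 2 * m) → 11 ≤ 1 + 2 * m →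
             (1 + 2 * m) % 3 ≢ 0 → Inv κ π → Inv κ (triple m refl l π)
inv-triple m π l 11≤v v%3≢0 h with unit-node m v%3≢0
... | gain≡ , unit≡ rewrite units-∷ (1 + 2 * m) (nodes π) | gain≡ | unit≡ =
  triple-step κ (weight (1 + 2 * m)) (denominator π) (totalWeight (nodes π)) (numerator π) (1 + 2 * m) _ _ 11≤v h

-- The vertex lies in none of the six classes, so no factor A / R is gained; the loss of `D` and the
-- growth 1 + 3n ≤ 4n go into the constant.
multiple-step : ∀ X W Y n r a → 1 ≤ n → (X * W) ^ q * r ≤ Y ^ q * (κ * (1 + 3 * n)) ^ p * a →
                (D * X * W) ^ q * r ≤ Y ^ q * (κ′ * n) ^ p * a
multiple-step X W Y n r a 1≤n h = begin
  (D * X * W) ^ q * r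
    ≡⟨ cong (_* r) (trans (cong (_^ q) (*-assoc D X W)) (^-distribʳ-* D (X * W) q)) ⟩
  D ^ q * (X * W) ^ q * r
    ≡⟨ *-assoc (D ^ q) _ r ⟩
  D ^ q * ((X * W) ^ q * r)
    ≤⟨ *-mono-≤ D^q≤[D*D]^p h ⟩
  (D * D) ^ p * (Y ^ q * (κ * (1 + 3 * n)) ^ p * a)
    ≡⟨ exchange ((D * D) ^ p) (Y ^ q) ((κ * (1 + 3 * n)) ^ p) a ⟩
  Y ^ q * ((D * D) ^ p * (κ * (1 + 3 * n)) ^ p) * a
    ≡⟨ cong (λ x → Y ^ q * x * a) (^-distribʳ-* (D * D) (κ * (1 + 3 * n)) p) ⟨
  Y ^ q * (D * D * (κ * (1 + 3 * n))) ^ p * a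
    ≤⟨ *-monoˡ-≤ a (*-monoʳ-≤ (Y ^ q) (^-monoˡ-≤ p
         (*-monoʳ-≤ (D * D) (*-monoʳ-≤ κ (+-monoˡ-≤ (3 * n) 1≤n))))) ⟩
  Y ^ q * (D * D * (κ * (4 * n))) ^ p * a
    ≡⟨ cong (λ x → Y ^ q * x ^ p * a) (trans (regroup D κ n) (cong (_* n) (sym κ′≡))) ⟩
  Y ^ q * (κ′ * n) ^ p * a ∎
  where
  open ≤-Reasoning
  exchange : ∀ a b c d → a * (b * c * d) ≡ b * (a * c) * d
  exchange = solve-∀
  regroup : ∀ d k n → d * d * (k * (4 * n)) ≡ 4 * (d * d) * k * n
  regroup = solve-∀

inv-multiple : ∀ m (π : Path (1 + 3 * (1 + 2 * m))) (l : 1 < 1 + 2 * m) →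
               (1 + 2 * m) % 3 ≡ 0 → Inv κ π → Inv κ′ (triple m refl l π)
inv-multiple m π l v%3≡0 h with multiple-node m v%3≡0
... | gain≡ , weight≡ , unit≡
  rewrite units-∷ (1 + 2 * m) (nodes π) | gain≡ | weight≡ | unit≡ |
          +-identityʳ (totalWeight (nodes π)) | +-identityʳ (numerator π) =
  multiple-step (denominator π) (totalWeight (nodes π)) (numerator π) (1 + 2 * m) _ _ (s≤s z≤n) h

-- The inductive step needs 11 ≤ n at triplings, so 5 and 7 are computed directly.
path₅ : Path 5
path₅ = triple 2 refl (s≤s (s≤s z≤n)) (halve 8 refl (halve 4 refl (halve 2 refl (halve 1 refl stop))))

path₇ : Path 7
path₇ =
  triple 3 refl (s≤s (s≤s z≤n)) (halve 11 refl (
  triple 5 refl (s≤s (s≤s z≤n)) (halve 17 refl (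
  triple 8 refl (s≤s (s≤s z≤n)) (halve 26 refl (halve 13 refl (
  triple 6 refl (s≤s (s≤s z≤n)) (halve 20 refl (halve 10 refl (halve 5 refl path₅))))))))))

opaque
  unfolding p

  -- The base cases are decided by evaluation. The constant 1 in place of `κ` would fail here, as
  -- 6163/2000 exceeds (34/11)^(99/100).
  inv₁ : Inv κ stop
  inv₁ = ≤ᵇ⇒≤ _ _ _

  inv₅ : Inv κ path₅
  inv₅ = ≤ᵇ⇒≤ _ _ _

  inv₇ : Inv κ path₇
  inv₇ = ≤ᵇ⇒≤ _ _ _

1+3*v≢0 : ∀ v → (1 + 3 * v) % 3 ≢ 0
1+3*v≢0 v eq with () ← trans (sym (trans (cong (λ w → (1 + w) % 3) (*-comm 3 v)) ([m+kn]%n≡m%n 1 v 3))) eq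

-- The hypothesis passes along the path: halving preserves it and 3n + 1 always satisfies it. Among
-- the odd n below 11 it rules out 3 and 9.
inv : (π : Path n) → n % 3 ≢ 0 → Inv κ π
inv stop                 _     = inv₁
inv (halve m refl π)     n%3≢0 = inv-halve κ m π (inv π λ m%3≡0 →
  n%3≢0 (trans (%-distribˡ-* 2 m 3) (cong (λ r → 2 * r % 3) m%3≡0)))
inv (triple 0 refl 1<1 π) _    = contradiction 1<1 (<-irrefl refl)
inv (triple 1 refl _ _)  n%3≢0 = contradiction refl n%3≢0
inv (triple 2 refl l π)  _     = subst (Inv κ) (Path-irrelevant path₅ (triple 2 refl l π)) inv₅
inv (triple 3 refl l π)  _     = subst (Inv κ) (Path-irrelevant path₇ (triple 3 refl l π)) inv₇
inv (triple 4 refl _ _)  n%3≢0 = contradiction refl n%3≢0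
inv (triple m@(suc (suc (suc (suc (suc k))))) refl l π) n%3≢0 =
  inv-triple m π l (s≤s (*-monoʳ-≤ 2 (m≤m+n 5 k))) n%3≢0 (inv π (1+3*v≢0 (1 + 2 * m)))

Inv-mono : ∀ {j k} (π : Path n) → j ≤ k → Inv j π → Inv k π
Inv-mono {n} π j≤k h = ≤-trans h (*-monoˡ-≤ (A ^ units (nodes π)) (*-monoʳ-≤ (numerator π ^ q) (^-monoˡ-≤ p (*-monoˡ-≤ n j≤k))))

-- A multiple of 3 remains one under halving, and its first tripling leads to a number prime to 3.
-- So the larger constant is paid at most once.
inv′ : (π : Path n) → Inv κ′ π
inv′ {n} π with n % 3 ≟ 0
inv′ π | no n%3≢0 = Inv-mono π κ≤κ′ (inv π n%3≢0)
inv′ (halve m refl π) | yes _ = inv-halve κ′ m π (inv′ π)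
inv′ (triple m refl l π) | yes n%3≡0 = inv-multiple m π l n%3≡0 (inv π (1+3*v≢0 (1 + 2 * m)))

-- Weight products under balanced proportions

product-map-* : ∀ {A : Set} (f g : A → ℕ) xs →
                product (map (λ x → f x * g x) xs) ≡ product (map f xs) * product (map g xs)
product-map-* f g []       = refl
product-map-* f g (x ∷ xs) = trans (cong (f x * g x *_) (product-map-* f g xs))
  (exchange (f x) (g x) (product (map f xs)) (product (map g xs)))
  where
  exchange : ∀ a b c d → a * b * (c * d) ≡ a * c * (b * d)
  exchange = solve-∀

product-map-^ : ∀ {A : Set} (f : A → ℕ) e xs → product (map (λ x → f x ^ e) xs) ≡ product (map f xs) ^ e
product-map-^ f e []       = sym (^-zeroˡ e)
product-map-^ f e (x ∷ xs) = trans (cong (f x ^ e *_) (product-map-^ f e xs))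
  (sym (^-distribʳ-* (f x) (product (map f xs)) e))

opaque
  unfolding D

  weight-factor-< : ∀ {r} → r < 18 → weightᵣ r ≡ product (map (λ i → weightᵣ i ^ δ i r) classes)
  weight-factor-< = from-yes (allUpTo? (λ r → weightᵣ r ≟ product (map (λ i → weightᵣ i ^ δ i r) classes)) 18)

totalWeight-factor : ∀ ms → totalWeight ms ≡ product (map (λ i → weightᵣ i ^ count i ms) classes)
totalWeight-factor []       = refl
totalWeight-factor (m ∷ ms) = begin
  weight m * totalWeight ms
    ≡⟨ cong₂ _*_ (weight-factor-< (m%n<n m 18)) (totalWeight-factor ms) ⟩
  product (map (λ i → weightᵣ i ^ δ i (m % 18)) classes) * product (map (λ i → weightᵣ i ^ count i ms) classes)
    ≡⟨ product-map-* (λ i → weightᵣ i ^ δ i (m % 18)) (λ i → weightᵣ i ^ count i ms) classes ⟨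
  product (map (λ i → weightᵣ i ^ δ i (m % 18) * weightᵣ i ^ count i ms) classes)
    ≡⟨ cong product (map-cong (λ i → ^-distribˡ-+-* (weightᵣ i) (δ i (m % 18)) (count i ms)) classes) ⟨
  product (map (λ i → weightᵣ i ^ count i (m ∷ ms)) classes) ∎
  where open ≡-Reasoning

-- Raises every exponent e x to t, each missing factor w x ≤ b being paid for by a b.
levelling : ∀ {A : Set} (w e : A → ℕ) b t xs → All (λ x → w x ≤ b × e x ≤ t) xs →
            product (map (λ x → w x ^ t) xs) ≤
            product (map (λ x → w x ^ e x) xs) * b ^ sum (map (λ x → t ∸ e x) xs)
levelling w e b t []       []              = ≤-refl
levelling w e b t (x ∷ xs) ((w≤b , e≤t) ∷ h) = begin
  w x ^ t * product (map (λ x → w x ^ t) xs)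
    ≤⟨ *-mono-≤ level (levelling w e b t xs h) ⟩
  w x ^ e x * b ^ (t ∸ e x) * (P * b ^ S)
    ≡⟨ exchange (w x ^ e x) (b ^ (t ∸ e x)) P (b ^ S) ⟩
  w x ^ e x * P * (b ^ (t ∸ e x) * b ^ S)
    ≡⟨ cong (w x ^ e x * P *_) (^-distribˡ-+-* b (t ∸ e x) S) ⟨
  w x ^ e x * P * b ^ (t ∸ e x + S) ∎
  where
  open ≤-Reasoning
  P = product (map (λ x → w x ^ e x) xs)
  S = sum (map (λ x → t ∸ e x) xs)
  exchange : ∀ a b c d → a * b * (c * d) ≡ a * c * (b * d)
  exchange = solve-∀
  level : w x ^ t ≤ w x ^ e x * b ^ (t ∸ e x)
  level = begin
    w x ^ t                          ≡⟨ cong (w x ^_) (m+[n∸m]≡n e≤t) ⟨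
    w x ^ (e x + (t ∸ e x))          ≡⟨ ^-distribˡ-+-* (w x) (e x) (t ∸ e x) ⟩
    w x ^ e x * w x ^ (t ∸ e x)      ≤⟨ *-monoʳ-≤ (w x ^ e x) (^-monoˡ-≤ (t ∸ e x) w≤b) ⟩
    w x ^ e x * b ^ (t ∸ e x)        ∎

others : List ℕ
others = 1 ∷ 5 ∷ 11 ∷ 13 ∷ 17 ∷ []

opaque
  unfolding D q

  -- The weight product of 21 vertices in the extremal distribution: one in class 7 and four in each
  -- of the other five.
  G : ℕ
  G = weightᵣ 7 * product (map weightᵣ others) ^ 4

  -- The decisive numerical fact: even in the extremal distribution the class weights make up for
  -- the factor A / R per vertex.
  A≤GR : A ^ 21 ≤ G ^ q * R ^ 21
  A≤GR = ≤ᵇ⇒≤ (A ^ 21) (G ^ q * R ^ 21) _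

  G≡ : G ≡ weightᵣ 7 * product (map weightᵣ others) ^ 4
  G≡ = refl

  others-≤ : All (λ i → weightᵣ i ≤ weightᵣ 7) others
  others-≤ = ≤ᵇ⇒≤ _ _ _ ∷ ≤ᵇ⇒≤ _ _ _ ∷ ≤ᵇ⇒≤ _ _ _ ∷ ≤ᵇ⇒≤ _ _ _ ∷ ≤ᵇ⇒≤ _ _ _ ∷ []

sum-map-∸ : ∀ {A : Set} (e : A → ℕ) t xs → All (λ x → e x ≤ t) xs →
            sum (map (λ x → t ∸ e x) xs) + sum (map e xs) ≡ length xs * t
sum-map-∸ e t []       []        = refl
sum-map-∸ e t (x ∷ xs) (le ∷ les) = trans
  (exchange (t ∸ e x) (sum (map (λ x → t ∸ e x) xs)) (e x) (sum (map e xs)))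
  (cong₂ _+_ (m∸n+n≡m le) (sum-map-∸ e t xs les))
  where
  exchange : ∀ a b c d → a + b + (c + d) ≡ a + c + (b + d)
  exchange = solve-∀

sum-map-* : ∀ {A : Set} (f : A → ℕ) k xs → sum (map (λ x → f x * k) xs) ≡ sum (map f xs) * k
sum-map-* f k []       = refl
sum-map-* f k (x ∷ xs) = trans (cong (λ s → f x * k + s) (sum-map-* f k xs)) (sym (*-distribʳ-+ k (f x) (sum (map f xs))))

-- Class 7 has the largest weight, so moving exponents from it to the other classes, until each of
-- these has 4t in the 21st power, can only lower the product. What is left for 7 is t, which gives
-- `G ^ t`.
balanced : ∀ ms → All (λ i → count i ms * 21 ≤ 4 * units ms) others → G ^ units ms ≤ totalWeight ms ^ 21
balanced ms bounds = begin
  G ^ t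
    ≡⟨ cong (_^ t) G≡ ⟩
  (b * P ^ 4) ^ t
    ≡⟨ ^-distribʳ-* b (P ^ 4) t ⟩
  b ^ t * (P ^ 4) ^ t
    ≡⟨ cong (b ^ t *_) (trans (^-*-assoc P 4 t) (sym (product-map-^ weightᵣ (4 * t) others))) ⟩
  b ^ t * product (map (λ i → weightᵣ i ^ (4 * t)) others)
    ≤⟨ *-monoʳ-≤ (b ^ t) (levelling weightᵣ e b (4 * t) others (All.zip (others-≤ , bounds))) ⟩
  b ^ t * (product (map (λ i → weightᵣ i ^ e i) others) * b ^ S)
    ≡⟨ exchange (b ^ t) (product (map (λ i → weightᵣ i ^ e i) others)) (b ^ S) ⟩
  b ^ t * b ^ S * product (map (λ i → weightᵣ i ^ e i) others)
    ≡⟨ cong (_* product (map (λ i → weightᵣ i ^ e i) others))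
         (trans (sym (^-distribˡ-+-* b t S)) (cong (b ^_) exponent)) ⟩
  b ^ e 7 * product (map (λ i → weightᵣ i ^ e i) others)
    ≡⟨ cong₂ _*_ (sym (^-*-assoc b (count 7 ms) 21))
         (trans (cong product (map-cong (λ i → sym (^-*-assoc (weightᵣ i) (count i ms) 21)) others))
           (product-map-^ (λ i → weightᵣ i ^ count i ms) 21 others)) ⟩
  (b ^ count 7 ms) ^ 21 * product (map (λ i → weightᵣ i ^ count i ms) others) ^ 21
    ≡⟨ ^-distribʳ-* (b ^ count 7 ms) (product (map (λ i → weightᵣ i ^ count i ms) others)) 21 ⟨
  (b ^ count 7 ms * product (map (λ i → weightᵣ i ^ count i ms) others)) ^ 21
    ≡⟨ cong (_^ 21) (trans (pull* (weightᵣ 1 ^ count 1 ms) (weightᵣ 5 ^ count 5 ms) (b ^ count 7 ms) _)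
         (sym (totalWeight-factor ms))) ⟩
  totalWeight ms ^ 21 ∎
  where
  open ≤-Reasoning
  t = units ms
  b = weightᵣ 7
  P = product (map weightᵣ others)
  e : ℕ → ℕ
  e i = count i ms * 21
  S = sum (map (λ i → 4 * t ∸ e i) others)
  O = sum (map (λ i → count i ms) others)
  exchange : ∀ a b c → a * (b * c) ≡ a * c * b
  exchange = solve-∀
  pull* : ∀ x y z r → z * (x * (y * r)) ≡ x * (y * (z * r))
  pull* = solve-∀
  pull+ : ∀ x y z r → x + (y + (z + r)) ≡ z + (x + (y + r))
  pull+ = solve-∀
  regroup : ∀ t S O → t + S + O * 21 ≡ t + (S + O * 21)
  regroup = solve-∀
  collect : ∀ t → t + 5 * (4 * t) ≡ t * 21
  collect = solve-∀
  -- The six counts add up to t, so the excess of `e 7` over t is the total deficit of the other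
  -- five exponents from 4t.
  exponent : t + S ≡ e 7
  exponent = +-cancelʳ-≡ (O * 21) (t + S) (e 7) (begin-equality
    t + S + O * 21           ≡⟨ regroup t S O ⟩
    t + (S + O * 21)         ≡⟨ cong (λ x → t + (S + x)) (sum-map-* (λ i → count i ms) 21 others) ⟨
    t + (S + sum (map e others)) ≡⟨ cong (λ s → t + s) (sum-map-∸ e (4 * t) others bounds) ⟩
    t + 5 * (4 * t)          ≡⟨ collect t ⟩
    t * 21                   ≡⟨ cong (_* 21) (pull+ (count 1 ms) (count 5 ms) (count 7 ms) _) ⟩
    (count 7 ms + O) * 21    ≡⟨ *-distribʳ-+ 21 (count 7 ms) O ⟩
    e 7 + O * 21             ∎)

-- Integer roots, and balanced paths of weight at least 1 / B

^-cancelˡ-≤ : ∀ m n e .{{_ : NonZero e}} → m ^ e ≤ n ^ e → m ≤ n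
^-cancelˡ-≤ m n e h with m ≤? n
... | yes m≤n = m≤n
... | no  m≰n = contradiction (^-monoˡ-< e (≰⇒> m≰n)) (≤⇒≯ h)

^-comm : ∀ m a b → (m ^ a) ^ b ≡ (m ^ b) ^ a
^-comm m a b = trans (^-*-assoc m a b) (trans (cong (m ^_) (*-comm a b)) (sym (^-*-assoc m b a)))

-- Supplies an integer `B` of the order of (κ′ N)^(p/q). In the induction on `m`, `b` grows by 1
-- only when it has become too small, and b + 1 ≤ 2b limits the overshoot.
root : ∀ e .{{_ : NonZero e}} m .{{_ : NonZero m}} → ∃ λ b → m ≤ b ^ e × b ^ e ≤ 2 ^ e * m
root e (suc zero)        = 1 , ≤-reflexive (sym (^-zeroˡ e)) ,
  ≤-trans (^-monoˡ-≤ e (s≤s z≤n)) (≤-reflexive (sym (*-identityʳ (2 ^ e))))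
root e (suc m@(suc _)) with b , m≤bᵉ , bᵉ≤2ᵉm ← root e m with suc m ≤? b ^ e
... | yes 1+m≤bᵉ = b , 1+m≤bᵉ , ≤-trans bᵉ≤2ᵉm (*-monoʳ-≤ (2 ^ e) (n≤1+n m))
... | no  1+m≰bᵉ = suc b , ≤-trans (s≤s m≤bᵉ) (^-monoˡ-< e (n<1+n b)) , (begin
    suc b ^ e      ≤⟨ ^-monoˡ-≤ e (≤-trans (+-monoˡ-≤ b (1≤b b m≤bᵉ)) (≤-reflexive (cong (λ s → b + s) (sym (+-identityʳ b))))) ⟩
    (2 * b) ^ e    ≡⟨ ^-distribʳ-* 2 b e ⟩
    2 ^ e * b ^ e  ≤⟨ *-monoʳ-≤ (2 ^ e) (≤-trans (≤-pred (≰⇒> 1+m≰bᵉ)) (n≤1+n m)) ⟩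
    2 ^ e * suc m  ∎)
  where
  open ≤-Reasoning
  0^e≡0 : ∀ e .{{_ : NonZero e}} → 0 ^ e ≡ 0
  0^e≡0 (suc e) = refl
  1≤b : ∀ b → m ≤ b ^ e → 1 ≤ b
  1≤b zero    h = contradiction (subst (m ≤_) (0^e≡0 e) h) λ ()
  1≤b (suc b) _ = s≤s z≤n

opaque
  unfolding D q

  nonZero-q : NonZero q
  nonZero-q = _

  nonZero-R : NonZero R
  nonZero-R = _

  nonZero-κ′ : NonZero κ′
  nonZero-κ′ = _

  weight-nonZero-< : ∀ {r} → r < 18 → 1 ≤ weightᵣ r
  weight-nonZero-< = from-yes (allUpTo? (λ r → 1 ≤? weightᵣ r) 18)

totalWeight-nonZero : ∀ ms → NonZero (totalWeight ms)
totalWeight-nonZero []       = _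
totalWeight-nonZero (m ∷ ms) =
  m*n≢0 (weight m) (totalWeight ms) {{>-nonZero (weight-nonZero-< (m%n<n m 18))}} {{totalWeight-nonZero ms}}

-- By `A≤GR` and `balanced`, the factor `A ^ s` in the invariant is at most `w ^ q * R ^ s`, which
-- then cancels. Powers of 21 are taken because the balance inequality concerns `w ^ 21`.
denominator-≤ : ∀ {B N} (π : Path n) → n ≤ N → (κ′ * N) ^ p ≤ B ^ q →
                All (λ i → count i (nodes π) * 21 ≤ 4 * units (nodes π)) others →
                denominator π ≤ numerator π * B
denominator-≤ {n} {B} {N} π n≤N Nᵖ≤Bᵠ bounds =
  ^-cancelˡ-≤ den (num * B) q {{nonZero-q}}
    (*-cancelʳ-≤ (den ^ q) ((num * B) ^ q) (w ^ q * R ^ s) {{nonZero-WR}}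
      (^-cancelˡ-≤ _ _ 21 powers))
  where
  open ≤-Reasoning
  den = denominator π
  num = numerator π
  w = totalWeight (nodes π)
  s = units (nodes π)
  nonZero-WR : NonZero (w ^ q * R ^ s)
  nonZero-WR = m*n≢0 (w ^ q) (R ^ s) {{m^n≢0 w q {{totalWeight-nonZero (nodes π)}}}} {{m^n≢0 R s {{nonZero-R}}}}
  Aˢ≤ : (A ^ s) ^ 21 ≤ (w ^ q * R ^ s) ^ 21
  Aˢ≤ = begin
    (A ^ s) ^ 21                   ≡⟨ ^-comm A s 21 ⟩
    (A ^ 21) ^ s                   ≤⟨ ^-monoˡ-≤ s A≤GR ⟩
    (G ^ q * R ^ 21) ^ s           ≡⟨ ^-distribʳ-* (G ^ q) (R ^ 21) s ⟩
    (G ^ q) ^ s * (R ^ 21) ^ s     ≡⟨ cong₂ _*_ (^-comm G q s) (^-comm R 21 s) ⟩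
    (G ^ s) ^ q * (R ^ s) ^ 21     ≤⟨ *-monoˡ-≤ ((R ^ s) ^ 21) (^-monoˡ-≤ q (balanced (nodes π) bounds)) ⟩
    (w ^ 21) ^ q * (R ^ s) ^ 21    ≡⟨ cong (_* (R ^ s) ^ 21) (^-comm w 21 q) ⟩
    (w ^ q) ^ 21 * (R ^ s) ^ 21    ≡⟨ ^-distribʳ-* (w ^ q) (R ^ s) 21 ⟨
    (w ^ q * R ^ s) ^ 21           ∎
  powers : (den ^ q * (w ^ q * R ^ s)) ^ 21 ≤ ((num * B) ^ q * (w ^ q * R ^ s)) ^ 21
  powers = begin
    (den ^ q * (w ^ q * R ^ s)) ^ 21
      ≡⟨ cong (_^ 21) (trans (sym (*-assoc (den ^ q) (w ^ q) (R ^ s))) (cong (_* R ^ s) (sym (^-distribʳ-* den w q)))) ⟩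
    ((den * w) ^ q * R ^ s) ^ 21
      ≤⟨ ^-monoˡ-≤ 21 (inv′ π) ⟩
    (num ^ q * (κ′ * n) ^ p * A ^ s) ^ 21
      ≤⟨ ^-monoˡ-≤ 21 (*-monoˡ-≤ (A ^ s) (*-monoʳ-≤ (num ^ q)
           (≤-trans (^-monoˡ-≤ p (*-monoʳ-≤ κ′ n≤N)) Nᵖ≤Bᵠ))) ⟩
    (num ^ q * B ^ q * A ^ s) ^ 21
      ≡⟨ cong (λ x → (x * A ^ s) ^ 21) (^-distribʳ-* num B q) ⟨
    ((num * B) ^ q * A ^ s) ^ 21
      ≡⟨ ^-distribʳ-* ((num * B) ^ q) (A ^ s) 21 ⟩
    ((num * B) ^ q) ^ 21 * (A ^ s) ^ 21
      ≤⟨ *-monoʳ-≤ (((num * B) ^ q) ^ 21) Aˢ≤ ⟩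
    ((num * B) ^ q) ^ 21 * (w ^ q * R ^ s) ^ 21
      ≡⟨ ^-distribʳ-* ((num * B) ^ q) (w ^ q * R ^ s) 21 ⟨
    ((num * B) ^ q * (w ^ q * R ^ s)) ^ 21 ∎

-- Comparison of orbits with paths

unique-⊆⇒length-≤ : ∀ {A : Set} {xs ys : List A} →
                    Unique xs → (∀ {x} → x ∈ xs → x ∈ ys) → length xs ≤ length ys
unique-⊆⇒length-≤ [] _ = z≤n
unique-⊆⇒length-≤ {xs = x ∷ xs} (x∉xs ∷ unique) xs⊆ys
  with as , bs , refl ← ∈-∃++ (xs⊆ys (here refl)) = begin
  suc (length xs)              ≤⟨ s≤s (unique-⊆⇒length-≤ unique xs⊆as++bs) ⟩
  suc (length (as ++ bs))      ≡⟨ cong suc (length-++ as) ⟩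
  suc (length as + length bs)  ≡⟨ +-suc (length as) (length bs) ⟨
  length as + suc (length bs)  ≡⟨ length-++ as ⟨
  length (as ++ x ∷ bs)        ∎
  where
  open ≤-Reasoning
  xs⊆as++bs : ∀ {y} → y ∈ xs → y ∈ as ++ bs
  xs⊆as++bs y∈xs with ∈-++⁻ as (xs⊆ys (there y∈xs))
  ... | inj₁ y∈as         = ∈-++⁺ˡ y∈as
  ... | inj₂ (here refl)  = contradiction refl (All.lookup x∉xs y∈xs)
  ... | inj₂ (there y∈bs) = ∈-++⁺ʳ as y∈bs

even⊎odd : ∀ n → (∃ λ m → n ≡ 2 * m) ⊎ (∃ λ m → n ≡ 1 + 2 * m)
even⊎odd zero    = inj₁ (0 , refl)
even⊎odd (suc n) with even⊎odd n
... | inj₁ (m , refl) = inj₂ (m , refl)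
... | inj₂ (m , refl) = inj₁ (suc m , cong suc (sym (+-suc m (m + 0))))

T-even : ∀ m → T (+ (2 * m)) ≡ + m
T-even m
  rewrite dec-true (+ 2 ℤ.∣? + (2 * m)) (ℤ.divides (+ m) (trans (ℤ.pos-* 2 m) (ℤ.*-comm (+ 2) (+ m)))) =
  cong +_ (trans (cong (_/ 2) (*-comm 2 m)) (m*n/n≡m m 2))

2∤odd : ∀ m → ¬ (+ 2 ℤ.∣ + (1 + 2 * m))
2∤odd m 2∣v with divides k eq ← ℤ.∣⇒∣ᵤ 2∣v = even≢odd k m (trans (*-comm 2 k) (sym eq))

T-odd : ∀ m → T (+ (1 + 2 * m)) ≡ + (1 + 3 * (1 + 2 * m))
T-odd m rewrite dec-false (+ 2 ℤ.∣? + (1 + 2 * m)) (2∤odd m) =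
  trans (cong (ℤ._+ 1ℤ) (sym (ℤ.pos-* 3 (1 + 2 * m)))) (cong +_ (+-comm (3 * (1 + 2 * m)) 1))

-- The time k need not be the first visit to 1, so `n` is compared with 1 before another step is
-- taken.
reaches⇒Path : ∀ k n → T^ k (+ n) ≡ 1ℤ → Path n
reaches⇒Path k       n  eq with n ≟ 1
reaches⇒Path k       .1 eq | yes refl = stop
reaches⇒Path zero    n  eq | no n≢1   = contradiction (ℤ.+-injective eq) n≢1
reaches⇒Path (suc k) n  eq | no n≢1 with even⊎odd n
... | inj₁ (m , refl)           = halve m refl (reaches⇒Path k m (trans (cong (T^ k) (sym (T-even m))) eq))
... | inj₂ (zero , refl)        = contradiction refl n≢1
... | inj₂ (m@(suc _) , refl)   = triple m refl (s≤s (s≤s z≤n))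
  (reaches⇒Path k _ (trans (cong (T^ k) (sym (T-odd m))) eq))

node⇒Path : ∀ (π : Path n) {m} → m ∈ nodes π → ∃ λ (π′ : Path m) → steps π′ ≤ steps π
node⇒Path stop               (here refl) = stop , z≤n
node⇒Path π@(halve _ _ _)    (here refl) = π , ≤-refl
node⇒Path (halve _ _ π)      (there m∈)  with π′ , le ← node⇒Path π m∈ = π′ , m≤n⇒m≤1+n le
node⇒Path π@(triple _ _ _ _) (here refl) = π , ≤-refl
node⇒Path (triple _ _ _ π)   (there m∈)  with π′ , le ← node⇒Path π m∈ = π′ , m≤n⇒m≤1+n le

-- The number of steps to 1 depends on the vertex only, so a path cannot meet a
-- vertex that lies further from 1 than its start.
longer⇒∉nodes : ∀ {m} (π : Path n) (π′ : Path m) → steps π < steps π′ → m ∉ nodes π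
longer⇒∉nodes π π′ lt m∈ with π″ , le ← node⇒Path π m∈ =
  <⇒≱ lt (subst (λ ρ → steps ρ ≤ steps π) (Path-irrelevant π″ π′) le)

nodes-unique : (π : Path n) → Unique (nodes π)
nodes-unique stop                = [] ∷ []
nodes-unique π@(halve _ _ π′)    = ¬Any⇒All¬ (nodes π′) (longer⇒∉nodes π′ π ≤-refl) ∷ nodes-unique π′
nodes-unique π@(triple _ _ _ π′) = ¬Any⇒All¬ (nodes π′) (longer⇒∉nodes π′ π ≤-refl) ∷ nodes-unique π′

nodes⊆orbit : (π : Path n) {m : ℕ} → m ∈ nodes π → Orbit (+ n) (+ m)
nodes⊆orbit stop                (here refl) = 0 , refl
nodes⊆orbit (halve _ _ _)       (here refl) = 0 , refl
nodes⊆orbit (halve m refl π)    (there x∈) with k , eq ← nodes⊆orbit π x∈ =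
  suc k , trans eq (cong (T^ k) (sym (T-even m)))
nodes⊆orbit (triple _ _ _ _)    (here refl) = 0 , refl
nodes⊆orbit (triple m refl _ π) (there x∈) with k , eq ← nodes⊆orbit π x∈ =
  suc k , trans eq (cong (T^ k) (sym (T-odd m)))

cycle : List ℤ
cycle = + 1 ∷ + 2 ∷ + 4 ∷ []

T^-cycle : ∀ k → T^ k (+ 1) ∈ cycle × T^ k (+ 2) ∈ cycle × T^ k (+ 4) ∈ cycle
T^-cycle zero    = here refl , there (here refl) , there (there (here refl))
-- `T` sends 1, 2, 4 to 4, 1, 2.
T^-cycle (suc k) with c₁ , c₂ , c₄ ← T^-cycle k = c₄ , c₁ , c₂

orbit⊆nodes : (π : Path n) (k : ℕ) → ∃ λ m → T^ k (+ n) ≡ + m × (m ∈ nodes π ⊎ m ≡ 2 ⊎ m ≡ 4)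
orbit⊆nodes stop k with proj₁ (T^-cycle k)
... | here eq                 = 1 , eq , inj₁ (here refl)
... | there (here eq)         = 2 , eq , inj₂ (inj₁ refl)
... | there (there (here eq)) = 4 , eq , inj₂ (inj₂ refl)
orbit⊆nodes {n} (halve _ _ _) zero = n , refl , inj₁ (here refl)
orbit⊆nodes (halve m refl π) (suc k) with x , eq , x∈ ← orbit⊆nodes π k =
  x , trans (cong (T^ k) (T-even m)) eq , Sum.map₁ there x∈
orbit⊆nodes {n} (triple _ _ _ _) zero = n , refl , inj₁ (here refl)
orbit⊆nodes (triple m refl _ π) (suc k) with x , eq , x∈ ← orbit⊆nodes π k =
  x , trans (cong (T^ k) (T-odd m)) eq , Sum.map₁ there x∈

-- Class counts, and the balance of paths from W

residue⇒≡[mod] : ∀ m i → m % 18 ≡ i → + m ≡ + i [mod + 18 ]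
residue⇒≡[mod] m _ refl = ℤ.∣ᵤ⇒∣ (divides (m / 18) (begin
  ℤ.∣ + m ℤ.- + (m % 18) ∣       ≡⟨ cong ℤ.∣_∣ (ℤ.m-n≡m⊖n m (m % 18)) ⟩
  ℤ.∣ m ℤ.⊖ m % 18 ∣             ≡⟨ cong ℤ.∣_∣ (ℤ.⊖-≥ (m%n≤m m 18)) ⟩
  m ∸ m % 18                     ≡⟨ cong (_∸ m % 18) (m≡m%n+[m/n]*n m 18) ⟩
  m % 18 + m / 18 * 18 ∸ m % 18  ≡⟨ m+n∸m≡n (m % 18) (m / 18 * 18) ⟩
  m / 18 * 18                    ∎))
  where open ≡-Reasoning

≡[mod]⇒residue : ∀ m i → i < 18 → + m ≡ + i [mod + 18 ] → m % 18 ≡ i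
≡[mod]⇒residue m i i<18 m≡i = residue (i ≤? m)
  where
  open ≡-Reasoning
  18∣m⊖i : 18 ℕ∣.∣ ℤ.∣ m ℤ.⊖ i ∣
  18∣m⊖i = subst (λ z → 18 ℕ∣.∣ ℤ.∣ z ∣) (ℤ.m-n≡m⊖n m i) (ℤ.∣⇒∣ᵤ m≡i)
  residue : Dec (i ≤ m) → m % 18 ≡ i
  residue (yes i≤m) with divides k eq ← subst (18 ℕ∣.∣_) (cong ℤ.∣_∣ (ℤ.⊖-≥ i≤m)) 18∣m⊖i = begin
    m % 18              ≡⟨ cong (_% 18) (m+[n∸m]≡n i≤m) ⟨
    (i + (m ∸ i)) % 18  ≡⟨ cong (λ x → (i + x) % 18) eq ⟩
    (i + k * 18) % 18   ≡⟨ [m+kn]%n≡m%n i k 18 ⟩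
    i % 18              ≡⟨ m<n⇒m%n≡m i<18 ⟩
    i                   ∎
  residue (no i≰m) = contradiction (subst (18 ℕ∣.∣_) (ℤ.∣⊖∣-≤ (<⇒≤ (≰⇒> i≰m))) 18∣m⊖i)
    (ℕ∣.>⇒∤ {{>-nonZero (m<n⇒0<n∸m (≰⇒> i≰m))}} (≤-<-trans (m∸n≤m i m) i<18))

count-filter : ∀ i ms → count i ms ≡ length (filter (λ m → m % 18 ≟ i) ms)
count-filter i []       = refl
count-filter i (m ∷ ms) with m % 18 ≡ᵇ i
... | true  = cong suc (count-filter i ms)
... | false = count-filter i ms

-- Beyond the path, the orbit contains only 1, 2 and 4.
class-size : ∀ (π : Path n) {i s} → i < 18 → i ≢ 2 → i ≢ 4 →
             HasSize (OrbitClass (+ i) (+ n)) s → s ≡ count i (nodes π)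
class-size {n} π {i} i<18 i≢2 i≢4 (xs , unique , enumerates , refl) = begin
  length xs                ≡⟨ ≤-antisym (unique-⊆⇒length-≤ unique xs⊆hits) (unique-⊆⇒length-≤ hits-unique hits⊆xs) ⟩
  length (map +_ hits)     ≡⟨ length-map +_ hits ⟩
  length hits              ≡⟨ count-filter i (nodes π) ⟨
  count i (nodes π)        ∎
  where
  open ≡-Reasoning
  hits : List ℕ
  hits = filter (λ m → m % 18 ≟ i) (nodes π)
  hits-unique : Unique (map +_ hits)
  hits-unique = Unique.map⁺ ℤ.+-injective (Unique.filter⁺ (λ m → m % 18 ≟ i) (nodes-unique π))
  xs⊆hits : ∀ {x} → x ∈ xs → x ∈ map +_ hits
  xs⊆hits {x} x∈ with Equivalence.to (enumerates x) x∈
  ... | (k , refl) , x≡i with orbit⊆nodes π k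
  ... | m , eq , m∈ rewrite eq with ≡[mod]⇒residue m i i<18 x≡i | m∈
  ... | m%18≡i | inj₁ m∈nodes     = ∈-map⁺ +_ (∈-filter⁺ (λ m → m % 18 ≟ i) m∈nodes m%18≡i)
  ... | m%18≡i | inj₂ (inj₁ refl) = contradiction (sym m%18≡i) i≢2
  ... | m%18≡i | inj₂ (inj₂ refl) = contradiction (sym m%18≡i) i≢4
  hits⊆xs : ∀ {x} → x ∈ map +_ hits → x ∈ xs
  hits⊆xs x∈
    with m , m∈ , refl ← ∈-map⁻ +_ x∈
    with m∈nodes , m%18≡i ← ∈-filter⁻ (λ m → m % 18 ≟ i) m∈ =
    Equivalence.from (enumerates (+ m)) (nodes⊆orbit π m∈nodes , residue⇒≡[mod] m i m%18≡i)

-- The unnormalised sum is (1·10000 + 215·6) / (6·10000), and the order on fractions is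
-- cross-multiplication.
ratio⇒≤ : ∀ c t .{{_ : NonZero t}} →
          (+ c) ℚ./ t ℚ.≤ (+ 1) ℚ./ 6 ℚ.+ (+ 215) ℚ./ 10000 → c * 60000 ≤ 11290 * t
ratio⇒≤ c t@(suc _) (*≤* h) =
  ℤ.drop‿+≤+ (subst₂ ℤ._≤_ (sym (ℤ.pos-* c 60000)) (sym (ℤ.pos-* 11290 t)) h)

-- 1/6 + 0.0215 = 11290/60000 ≤ 4/21.
c*21≤4*t : ∀ c t → c * 60000 ≤ 11290 * t → c * 21 ≤ 4 * t
c*21≤4*t c t h = *-cancelʳ-≤ (c * 21) (4 * t) 60000 (begin
  c * 21 * 60000   ≡⟨ exchange c 21 60000 ⟩
  c * 60000 * 21   ≤⟨ *-monoˡ-≤ 21 h ⟩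
  11290 * t * 21   ≡⟨ exchange 11290 t 21 ⟩
  11290 * 21 * t   ≤⟨ *-monoˡ-≤ t (≤ᵇ⇒≤ (11290 * 21) (4 * 60000) _) ⟩
  4 * 60000 * t    ≡⟨ exchange 4 60000 t ⟩
  4 * t * 60000    ∎)
  where
  open ≤-Reasoning
  exchange : ∀ a b c → a * b * c ≡ a * c * b
  exchange = solve-∀

class-bounds : All (λ i → i < 18 × i ≢ 2 × i ≢ 4) classes
class-bounds = from-yes (All.all? (λ i → i <? 18 ×-dec ¬? (i ≟ 2) ×-dec ¬? (i ≟ 4)) classes)

others⊆classes : All (_∈ classes) others
others⊆classes = from-yes (All.all? (_∈? classes) others)

W⇒balanced : W (+ n) → ∃ λ (π : Path n) → All (λ i → count i (nodes π) * 21 ≤ 4 * units (nodes π)) others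
W⇒balanced {n} w = π , All.map bound others⊆classes
  where
  open W w
  π : Path n
  π = reaches⇒Path (proj₁ reaches-1) n (proj₂ reaches-1)
  size : ∀ {i} → i ∈ classes → c (+ i) ≡ count i (nodes π)
  size i∈ with i<18 , i≢2 , i≢4 ← All.lookup class-bounds i∈ =
    class-size π i<18 i≢2 i≢4 (isCount (∈-map⁺ +_ i∈))
  total≡units : total c ≡ units (nodes π)
  total≡units = cong sum (map-cong-local {xs = classes} (All.tabulate size))
  bound : ∀ {i} → i ∈ classes → count i (nodes π) * 21 ≤ 4 * units (nodes π)
  bound {i} i∈ = subst₂ (λ a t → a * 21 ≤ 4 * t) (size i∈) total≡units
    (c*21≤4*t (c (+ i)) (total c) (ratio⇒≤ (c (+ i)) (total c) (ratio≤ (∈-map⁺ +_ i∈))))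

-- Counting the vertices of weight at least 1 / B

Light : ℕ → ℤ → Set
Light B x = ∃ λ m → ∃ λ (π : Path m) → x ≡ + m × denominator π ≤ numerator π * B

-- A single height must serve all entries, so the maximum of the path lengths is taken and every
-- larger height is allowed.
light⊆tree : ∀ {B xs} → All (Light B) xs →
             ∃ λ K → ∀ fuel → K ≤ fuel → All (_∈ map +_ (tree B (suc fuel) 1 1 1)) xs
light⊆tree [] = 0 , λ _ _ → []
light⊆tree {B} ((m , π , refl , light) ∷ rest) with K , covers ← light⊆tree rest =
  steps π ⊔ K , λ fuel le →
    ∈-map⁺ +_ (reached fuel (m⊔n≤o⇒m≤o (steps π) K le)) ∷ covers fuel (m⊔n≤o⇒n≤o (steps π) K le)
  where
  reached : ∀ fuel → steps π ≤ fuel → m ∈ tree B (suc fuel) 1 1 1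
  reached fuel le = subst (λ f → m ∈ tree B f 1 1 1)
    (trans (+-suc (steps π) (fuel ∸ steps π)) (cong suc (m+[n∸m]≡n le)))
    (tree-extend (suc (fuel ∸ steps π)) π (root∈tree (fuel ∸ steps π) light))

-- The height may depend on `xs`, since the bound of `length-tree` does not involve it.
light-length : ∀ {B xs} → Unique xs → All (Light B) xs → length xs ≤ B * potential 1
light-length {B} {xs} unique light with K , covers ← light⊆tree light = begin
  length xs              ≤⟨ unique-⊆⇒length-≤ unique (All.lookup (covers K ≤-refl)) ⟩
  length (map +_ found)  ≡⟨ length-map +_ found ⟩
  length found           ≡⟨ *-identityʳ (length found) ⟨
  length found * 1       ≤⟨ length-tree B (suc K) 1 1 1 ⟩
  1 * B * potential 1    ≡⟨ cong (_* potential 1) (*-identityˡ B) ⟩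
  B * potential 1        ∎
  where
  open ≤-Reasoning
  found = tree B (suc K) 1 1 1

-- The bound O(N^(99/100)) and removal of the constant

C₀ : ℕ
C₀ = 2 ^ q * κ′ ^ p * potential 1 ^ q

members-light : ∀ {B N x} → (κ′ * N) ^ p ≤ B ^ q → (W ∩ [1⋯ N ]) x → Light B x
members-light {x = + m} Nᵖ≤Bᵠ (w , _ , ℤ.+≤+ m≤N) =
  let π , bounds = W⇒balanced w in m , π , refl , denominator-≤ π m≤N Nᵖ≤Bᵠ bounds
members-light {x = ℤ.-[1+ _ ]} _ (_ , () , _)

length-≤ : ∀ {B} N xs → Unique xs → All (W ∩ [1⋯ N ]) xs →
           (κ′ * N) ^ p ≤ B ^ q → B ^ q ≤ 2 ^ q * (κ′ * N) ^ p → length xs ^ q ≤ C₀ * N ^ p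
length-≤ {B} N xs unique members Nᵖ≤Bᵠ Bᵠ≤ = begin
  length xs ^ q
    ≤⟨ ^-monoˡ-≤ q (light-length unique (All.map (members-light Nᵖ≤Bᵠ) members)) ⟩
  (B * potential 1) ^ q
    ≡⟨ ^-distribʳ-* B (potential 1) q ⟩
  B ^ q * potential 1 ^ q
    ≤⟨ *-monoˡ-≤ (potential 1 ^ q) Bᵠ≤ ⟩
  2 ^ q * (κ′ * N) ^ p * potential 1 ^ q
    ≡⟨ cong (λ x → 2 ^ q * x * potential 1 ^ q) (^-distribʳ-* κ′ N p) ⟩
  2 ^ q * (κ′ ^ p * N ^ p) * potential 1 ^ q
    ≡⟨ exchange (2 ^ q) (κ′ ^ p) (N ^ p) (potential 1 ^ q) ⟩
  C₀ * N ^ p ∎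
  where
  open ≤-Reasoning
  exchange : ∀ a b c d → a * (b * c) * d ≡ a * b * d * c
  exchange = solve-∀

-- In g-th powers the constant becomes `K ^ g`, which costs at most one factor `N`.
absorb : ∀ l K N e f g h .{{_ : NonZero N}} →
         l ^ e ≤ K * N ^ f → K ^ g ≤ N → l ^ (e * g) ≤ N ^ (suc h + f * g)
absorb l K N e f g h lᵉ≤ Kᵍ≤N = begin
  l ^ (e * g)              ≡⟨ ^-*-assoc l e g ⟨
  (l ^ e) ^ g              ≤⟨ ^-monoˡ-≤ g lᵉ≤ ⟩
  (K * N ^ f) ^ g          ≡⟨ ^-distribʳ-* K (N ^ f) g ⟩
  K ^ g * (N ^ f) ^ g      ≤⟨ *-mono-≤ (≤-trans Kᵍ≤N (m≤m*n N (N ^ h) {{m^n≢0 N h}})) (≤-reflexive (^-*-assoc N f g)) ⟩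
  N ^ suc h * N ^ (f * g)  ≡⟨ ^-distribˡ-+-* N (suc h) (f * g) ⟨
  N ^ (suc h + f * g)      ∎
  where open ≤-Reasoning

W-bound : ∀ g h a b .{{_ : NonZero a}} → q * g ≡ a → suc h + p * g ≡ b →
          ∃ λ N₀ → ∀ N → N₀ ≤ N → # (W ∩ [1⋯ N ]) ≤ N ^[ b / a ]
-- The successor also ensures that `N` is positive.
W-bound g h _ _ refl refl = suc (C₀ ^ g) , bound
  where
  bound : ∀ N → suc (C₀ ^ g) ≤ N → ∀ xs → Unique xs → All (W ∩ [1⋯ N ]) xs →
          length xs ^ (q * g) ≤ N ^ (suc h + p * g)
  bound N@(suc _) N₀≤N xs unique members =
    let _ , ≤Bᵠ , Bᵠ≤ = root q {{nonZero-q}} ((κ′ * N) ^ p) {{m^n≢0 (κ′ * N) p {{m*n≢0 κ′ N {{nonZero-κ′}}}}}}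
    in absorb (length xs) C₀ N q p g h (length-≤ N xs unique members ≤Bᵠ Bᵠ≤)
         (≤-trans (n≤1+n (C₀ ^ g)) N₀≤N)

opaque
  unfolding q

  q*100≡10000 : q * 100 ≡ 10000
  q*100≡10000 = refl

  99+p*100≡9999 : 99 + p * 100 ≡ 9999
  99+p*100≡9999 = refl

theorem1 : ∃ λ (N₀ : ℕ) → ∀ (N : ℕ) → N₀ ≤ N → # (W ∩ [1⋯ N ]) ≤ N ^[ 9999 / 10000 ]
-- With g = 100 the exponent 99/100 becomes 9900/10000, and suc 98 = 99 raises it to 9999/10000.
theorem1 = W-bound 100 98 10000 9999 q*100≡10000 99+p*100≡9999
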